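{- For all integers $n\ge d\ge1$, $\rho(n,d)\le n-d$. Furthermore, if $n>2d$, then $\rho(n,d)\le n-d-1$.
   Context: Strings are indexed from 1. An integer $p\ge1$ is a period of $s$ if $s[m]=s[m+p]$ for all $1\le m\le |s|-p$. A run of a string $w$ of length $n$ is a triple $(i,j,p)$ with $1\le i\le j\le n$ such that $p$ is the smallest period of $w[i..j]$, $j-i+1\ge 2p$, ($i=1$ or $w[i-1]\ne w[i+p-1]$), and ($j=n$ or $w[j+1]\ne w[j-p+1]$). $\rho(n,d)$ is the maximum number of runs in a string of length $n$ that contains exactly $d$ distinct symbols. -}

module Defs where

open import Data.Nat using (ℕ; zero; suc; _+_; _*_; _∸_; _≤_; _<_)
open import Data.Vec using (Vec; []; _∷_)
open import Data.Vec.Membership.Propositional as VM using ()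
open import Data.List using (List; length)
open import Data.List.Membership.Propositional as LM using ()
open import Data.List.Relation.Unary.All using (All)
open import Data.List.Relation.Unary.Unique.Propositional using (Unique)
open import Data.Product using (Σ; _×_; _,_)
open import Data.Sum using (_⊎_)
open import Relation.Binary.PropositionalEquality using (_≡_; _≢_)
open import Relation.Nullary using (¬_)
open import Function.Bundles using (_⇔_)

-- Strings of length n are vectors of symbols; symbols are natural numbers.

-- 1-indexed access: at w k = w[k] for 1 ≤ k ≤ n.  (Out-of-range positions
-- return 0, but every use below is guarded so that only in-range positions
-- are ever read.)
at : ∀ {n} → Vec ℕ n → ℕ → ℕ
at []            _             = 0
at (x ∷ xs)      zero          = 0
at (x ∷ xs)      (suc zero)    = x
at (x ∷ xs)      (suc (suc k)) = at xs (suc k)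

-- p is a period of the factor w[i..j] (of length j - i + 1):
-- s[m] = s[m+p] for all 1 ≤ m ≤ |s| - p, where s[m] = w[i+m-1].
IsPeriodOf : ∀ {n} → Vec ℕ n → ℕ → ℕ → ℕ → Set
IsPeriodOf w i j p =
  1 ≤ p ×
  (∀ m → 1 ≤ m → m + p ≤ (j + 1) ∸ i →
     at w (i + m ∸ 1) ≡ at w (i + m ∸ 1 + p))

IsSmallestPeriodOf : ∀ {n} → Vec ℕ n → ℕ → ℕ → ℕ → Set
IsSmallestPeriodOf w i j p =
  IsPeriodOf w i j p × (∀ q → q < p → ¬ IsPeriodOf w i j q)

IsRun : ∀ {n} → Vec ℕ n → ℕ × ℕ × ℕ → Set
IsRun {n} w (i , j , p) =
  1 ≤ i × i ≤ j × j ≤ n ×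
  IsSmallestPeriodOf w i j p ×
  2 * p ≤ (j + 1) ∸ i ×
  (i ≡ 1 ⊎ at w (i ∸ 1) ≢ at w (i + p ∸ 1)) ×
  (j ≡ n ⊎ at w (j + 1) ≢ at w ((j + 1) ∸ p))

-- "w has at most k runs": every duplicate-free list of runs of w has
-- length at most k (i.e. the finite set of runs has cardinality ≤ k).
RunsAtMost : ∀ {n} → Vec ℕ n → ℕ → Set
RunsAtMost w k =
  (rs : List (ℕ × ℕ × ℕ)) → Unique rs → All (IsRun w) rs → length rs ≤ k

HasDistinctSymbols : ∀ {n} → Vec ℕ n → ℕ → Set
HasDistinctSymbols w d =
  Σ (List ℕ) λ xs → Unique xs × length xs ≡ d ×
    (∀ a → (a LM.∈ xs) ⇔ (a VM.∈ w))

RhoAtMost : ℕ → ℕ → ℕ → Set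
RhoAtMost n d k = (w : Vec ℕ n) → HasDistinctSymbols w d → RunsAtMost w k

{-# OPTIONS --safe #-}
module Submission where

-- Order the letters by their last occurrence. Each run r of period p, read in the order ≺ or
-- its reverse according to how the period breaks at the right end, contains a Lyndon root
-- starting at a position b that is not the first of r; then b + p is the next position after b
-- with a smaller suffix, and therefore b determines r. With this particular order of the
-- letters, b is never the last occurrence of its letter, except when r is the square of a
-- letter ending at the last occurrence of that letter, in which case the first position of r
-- may be used instead. So runs inject into the n - d positions that are not last occurrences.
-- The least position whose letter occurs again at distance two or more is also missed, and it
-- exists unless every letter occurs at most twice, which forces n ≤ 2d.

open import Defs
open import Algebra.Properties.CommutativeSemigroup using (xy∙z≈xz∙y)
open import Data.Fin as Fin using ()
open import Data.Fin.Properties using (injective⇒≤)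
open import Data.List using (List; []; _∷_; _++_; applyUpTo; length; lookup; map)
open import Data.List.Membership.Propositional using (_∈_)
open import Data.List.Membership.Propositional.Properties using (∈-++⁺ˡ; ∈-++⁺ʳ; ∈-applyUpTo⁺; ∈-applyUpTo⁻; ∈-lookup; ∈-map⁺)
open import Data.List.Membership.Setoid.Properties using (index-injective)
open import Data.List.Properties using (length-++; length-applyUpTo; length-map)
open import Data.List.Relation.Unary.All as All using (All; []; _∷_)
open import Data.List.Relation.Unary.All.Properties as All using ()
open import Data.List.Relation.Unary.AllPairs using ([]; _∷_)
open import Data.List.Relation.Unary.Any using (here; there; index)
open import Data.List.Relation.Unary.Unique.Propositional using (Unique)
open import Data.List.Relation.Unary.Unique.Propositional.Properties as Unique using ()
open import Data.Nat using (ℕ; zero; suc; pred; _+_; _*_; _∸_; _≤_; _<_; _>_; z≤n; s≤s; _%_; _/_; _≤?_; _<?_; _≟_)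
open import Data.Nat.DivMod using ([m+n]%n≡m%n; [m+kn]%n≡m%n; m%n<n; m<n⇒m%n≡m; m≡m%n+[m/n]*n; m%n%n≡m%n)
open import Data.Nat.Induction using (<-rec)
open import Data.Nat.Properties hiding (_≟_; _≤?_; _<?_)
open import Data.Nat.Tactic.RingSolver using (solve-∀)
open import Data.Product using (∃; _×_; _,_; proj₁; proj₂)
open import Data.Sum using (_⊎_; inj₁; inj₂)
open import Data.Vec using (Vec; _∷_)
open import Data.Vec.Membership.Propositional as VM using ()
open import Data.Vec.Relation.Unary.Any as VAny using ()
open import Function.Bundles using (Equivalence)
open import Level using (0ℓ)
import Relation.Binary.Construct.Flip.EqAndOrd as Flip
open import Relation.Binary.Core using (Rel)
open import Relation.Binary.Definitions using (Decidable; Transitive; tri<; tri≈; tri>)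
open import Relation.Binary.PropositionalEquality using (_≡_; _≢_; refl; sym; trans; cong; cong₂; subst; subst₂; setoid; module ≡-Reasoning)
open import Relation.Binary.Structures using (IsStrictTotalOrder)
open import Relation.Nullary using (¬_; yes; no; contradiction)

-- Lexicographic order on infinite sequences, and least rotations.

Seq : Set
Seq = ℕ → ℕ

dropₛ : ℕ → Seq → Seq
dropₛ b f k = f (b + k)

-- Sequences are infinite, so no case of one word being a prefix of another arises: the first
-- mismatch decides.
Lex : Rel ℕ 0ℓ → Rel Seq 0ℓ
Lex _≺_ f g = ∃ λ s → (∀ k → k < s → f k ≡ g k) × f s ≺ g s

Lex-flip : ∀ {f g} → Lex _>_ f g → Lex _<_ g f
Lex-flip (s , eq , lt) = s , (λ k k<s → sym (eq k k<s)) , lt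

minimal : {_⊏_ : Rel ℕ 0ℓ} → Decidable _⊏_ → Transitive _⊏_ → (∀ x → ¬ x ⊏ x) →
          ∀ m → ∃ λ b → b ≤ m × (∀ c → c ≤ m → ¬ c ⊏ b)
minimal dec tr irr zero = 0 , z≤n , λ { _ z≤n → irr 0 }
minimal {_⊏_} dec tr irr (suc m) with minimal dec tr irr m
... | b , b≤m , min with dec (suc m) b
...   | yes lt = suc m , ≤-refl , below
  where
  below : ∀ c → c ≤ suc m → ¬ c ⊏ suc m
  below c c≤ with m≤n⇒m<n∨m≡n c≤
  ... | inj₁ (s≤s c≤m) = λ c⊏ → min c c≤m (tr c⊏ lt)
  ... | inj₂ refl      = irr (suc m)
...   | no ¬lt = b , m≤n⇒m≤1+n b≤m , below
  where
  below : ∀ c → c ≤ suc m → ¬ c ⊏ b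
  below c c≤ with m≤n⇒m<n∨m≡n c≤
  ... | inj₁ (s≤s c≤m) = min c c≤m
  ... | inj₂ refl      = ¬lt

module LexOrder {_≺_ : Rel ℕ 0ℓ} (O : IsStrictTotalOrder _≡_ _≺_) where
  private module O = IsStrictTotalOrder O

  Lex-resp : ∀ {f f′ g g′} → (∀ k → f k ≡ f′ k) → (∀ k → g k ≡ g′ k) →
             Lex _≺_ f g → Lex _≺_ f′ g′
  Lex-resp ff gg (s , eq , lt) =
    s , (λ k k<s → trans (sym (ff k)) (trans (eq k k<s) (gg k))) , subst₂ _≺_ (ff s) (gg s) lt

  Lex-irrefl : ∀ {f g} → (∀ k → f k ≡ g k) → ¬ Lex _≺_ f g
  Lex-irrefl eq (s , _ , lt) = O.irrefl (eq s) lt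

  Lex-trans : ∀ {f g h} → Lex _≺_ f g → Lex _≺_ g h → Lex _≺_ f h
  Lex-trans {f} {g} {h} (s , eq , lt) (s′ , eq′ , lt′) with <-cmp s s′
  ... | tri< s<s′ _ _ =
    s , (λ k k<s → trans (eq k k<s) (eq′ k (<-trans k<s s<s′))) , subst (f s ≺_) (eq′ s s<s′) lt
  ... | tri≈ _ refl _ = s , (λ k k<s → trans (eq k k<s) (eq′ k k<s)) , O.trans lt lt′
  ... | tri> _ _ s′<s =
    s′ , (λ k k<s → trans (eq k (<-trans k<s s′<s)) (eq′ k k<s)) , subst (_≺ h s′) (sym (eq s′ s′<s)) lt′

  Lex-asym : ∀ {f g} → Lex _≺_ f g → ¬ Lex _≺_ g f
  Lex-asym p q = Lex-irrefl (λ _ → refl) (Lex-trans p q)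

  Lex-drop : ∀ {f g} q → (∀ k → k < q → f k ≡ g k) → Lex _≺_ f g → Lex _≺_ (dropₛ q f) (dropₛ q g)
  Lex-drop {f} {g} q eq (s , eq′ , lt) with s <? q
  ... | yes s<q = contradiction lt (O.irrefl (eq s s<q))
  ... | no s≮q  = s ∸ q , (λ k k<s∸q → eq′ (q + k) (subst (q + k <_) q+s∸q (+-monoʳ-< q k<s∸q))) ,
                  subst (λ x → f x ≺ g x) (sym q+s∸q) lt
    where
    q+s∸q : q + (s ∸ q) ≡ s
    q+s∸q = m+[n∸m]≡n (≮⇒≥ s≮q)

  -- Equality of infinite sequences cannot be decided, so only `m` letters are inspected; for
  -- rotations of a periodic sequence one period suffices.
  Lex-compare : ∀ f g m → (∀ k → k < m → f k ≡ g k) ⊎ (Lex _≺_ f g ⊎ Lex _≺_ g f)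
  Lex-compare f g zero = inj₁ λ _ ()
  Lex-compare f g (suc m) with Lex-compare f g m
  ... | inj₂ r = inj₂ r
  ... | inj₁ eq with O.compare (f m) (g m)
  ...   | tri< lt _ _ = inj₂ (inj₁ (m , eq , lt))
  ...   | tri> _ _ gt = inj₂ (inj₂ (m , (λ k k<m → sym (eq k k<m)) , gt))
  ...   | tri≈ _ e _  = inj₁ upTo-m
    where
    upTo-m : ∀ k → k < suc m → f k ≡ g k
    upTo-m k (s≤s k≤m) with m≤n⇒m<n∨m≡n k≤m
    ... | inj₁ k<m  = eq k k<m
    ... | inj₂ refl = e

  -- The least rotation of a word with no smaller cyclic period is a Lyndon word.
  module _ {P : Seq} {q : ℕ} (periodic : ∀ k → P (k % suc q) ≡ P k) where
    private
      p = suc q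

    same-residue : ∀ {x y} → x % p ≡ y % p → P x ≡ P y
    same-residue {x} {y} e = trans (sym (periodic x)) (trans (cong P e) (periodic y))

    shift : ∀ x m → P (x + m * p) ≡ P x
    shift x m = same-residue ([m+kn]%n≡m%n x m p)

    shift₁ : ∀ x → P (x + p) ≡ P x
    shift₁ x = same-residue ([m+n]%n≡m%n x p)

    agree-everywhere : ∀ {x y} → (∀ k → k < p → P (x + k) ≡ P (y + k)) → ∀ k → P (x + k) ≡ P (y + k)
    agree-everywhere {x} {y} eq k = trans (reduce x) (trans (eq (k % p) (m%n<n k p)) (sym (reduce y)))
      where
      reduce : ∀ z → P (z + k) ≡ P (z + k % p)
      reduce z = trans (cong P (trans (cong (z +_) (m≡m%n+[m/n]*n k p)) (sym (+-assoc z (k % p) _))))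
                       (shift (z + k % p) (k / p))

    _⊏_ : Rel ℕ 0ℓ
    x ⊏ y = Lex _≺_ (dropₛ x P) (dropₛ y P)

    ⊏-dec : Decidable _⊏_
    ⊏-dec x y with Lex-compare (dropₛ x P) (dropₛ y P) p
    ... | inj₁ eq        = no (Lex-irrefl (agree-everywhere {x} {y} eq))
    ... | inj₂ (inj₁ lt) = yes lt
    ... | inj₂ (inj₂ gt) = no (Lex-asym gt)

    -- The starts searched are 1 to `p` rather than 0 to `q`, so that the root found later never
    -- begins at the first position of its run.
    least-rotation : ∃ λ b → b < p × (∀ c → ¬ c ⊏ suc b)
    least-rotation with minimal {λ x y → suc x ⊏ suc y} (λ x y → ⊏-dec (suc x) (suc y)) Lex-trans
                                (λ x → Lex-irrefl {dropₛ (suc x) P} λ _ → refl) q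
    ... | b , b≤q , min = b , s≤s b≤q , least
      where
      least : ∀ c → ¬ c ⊏ suc b
      -- Modulo `p`, `c + q` is `c` minus one, so its successor is the representative of `c` between
      -- 1 and `p`.
      least c lt = min ((c + q) % p) (≤-pred (m%n<n (c + q) p))
                       (Lex-resp {dropₛ c P} {_} {dropₛ (suc b) P} same (λ _ → refl) lt)
        where
        r = (c + q) % p
        same : ∀ k → P (c + k) ≡ P (suc r + k)
        same k = trans (sym (shift₁ (c + k))) (trans (cong P rearrange) (shift (suc r + k) ((c + q) / p)))
          where
          arith₁ : ∀ c k q → c + k + suc q ≡ suc (c + q) + k
          arith₁ = solve-∀
          arith₂ : ∀ r k m → suc (r + m) + k ≡ suc r + k + m
          arith₂ = solve-∀
          rearrange : c + k + p ≡ suc r + k + (c + q) / p * p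
          rearrange = trans (arith₁ c k q)
            (trans (cong (λ z → suc z + k) (m≡m%n+[m/n]*n (c + q) p)) (arith₂ r k _))

    aperiodic⇒strict : (∀ t → 0 < t → t < p → ¬ (∀ k → P k ≡ P (k + t))) →
      ∀ {b} → (∀ c → ¬ c ⊏ b) → ∀ t → 0 < t → t < p → b ⊏ (b + t)
    aperiodic⇒strict aper {b} least t 0<t t<p with Lex-compare (dropₛ b P) (dropₛ (b + t) P) p
    ... | inj₂ (inj₁ lt) = lt
    ... | inj₂ (inj₂ gt) = contradiction gt (least (b + t))
    ... | inj₁ eq        = contradiction everywhere (aper t 0<t t<p)
      where
      arith₁ : ∀ k b q → k + b * suc q ≡ b + (k + b * q)
      arith₁ = solve-∀
      arith₂ : ∀ k b q t → b + t + (k + b * q) ≡ k + t + b * suc q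
      arith₂ = solve-∀
      everywhere : ∀ k → P k ≡ P (k + t)
      -- Adding `b` whole periods moves `k` to a position not before `b`, where the agreement of the
      -- two rotations applies.
      everywhere k = trans (sym (shift k b)) (trans (cong P (arith₁ k b q))
        (trans (agree-everywhere {b} {b + t} eq (k + b * q))
               (trans (cong P (arith₂ k b q t)) (shift (k + t) b))))

-- Runs and their Lyndon roots.

-- A run w[i..j] of period p is recorded as a = i - 1 and c = j + 1 - p, so that (a , c) is a
-- maximal open interval on which L k ≡ L (k + p).
record Run (L : Seq) (a c p : ℕ) : Set where
  field
    positive : 0 < p
    long     : a + p < c
    left     : L a ≢ L (a + p)
    repeats  : ∀ k → a < k → k < c → L k ≡ L (k + p)
    right    : L c ≢ L (c + p)
    smallest : ∀ t → 0 < t → t < p → ¬ (∀ k → a < k → k + t < c + p → L k ≡ L (k + t))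

-- suc x + p is the next position after suc x whose suffix is ≺-smaller; equivalently, the
-- factor of length p at suc x is the longest ≺-Lyndon word starting there.
Root : Rel ℕ 0ℓ → Seq → ℕ → ℕ → Set
Root _≺_ L x p =
  (∀ t → 0 < t → t < p → Lex _≺_ (dropₛ (suc x) L) (dropₛ (suc x + t) L)) ×
  Lex _≺_ (dropₛ (suc x + p) L) (dropₛ (suc x) L)

module RootsOf {_≺_ : Rel ℕ 0ℓ} (O : IsStrictTotalOrder _≡_ _≺_) (L : Seq) where
  open LexOrder O

  -- The root is the least rotation of `P`, the periodic extension of the run. Minimality of the
  -- period makes it Lyndon; the way the period breaks at `c` makes the suffix one period later
  -- smaller.
  root-exists : ∀ {a c p} → Run L a c p → L (c + p) ≺ L c →
                ∃ λ x → a < x × x ≤ a + p × Root _≺_ L x p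
  root-exists {p = zero} r = contradiction (Run.positive r) λ ()
  root-exists {a} {c} {p@(suc q)} r end = x , m<m+n a (s≤s z≤n) , +-monoʳ-≤ a b<p , lyndon , descent
    where
    open Run r

    P : Seq
    P k = L (suc a + k % p)

    P-periodic : ∀ k → P (k % p) ≡ P k
    P-periodic k = cong (λ z → L (suc a + z)) (m%n%n≡m%n k p)

    P≡L : ∀ k → suc a + k < c + p → P k ≡ L (suc a + k)
    P≡L = <-rec _ step
      where
      step : ∀ k → (∀ {k′} → k′ < k → suc a + k′ < c + p → P k′ ≡ L (suc a + k′)) →
             suc a + k < c + p → P k ≡ L (suc a + k)
      step k ih k< with k <? p
      ... | yes k<p = cong (λ z → L (suc a + z)) (m<n⇒m%n≡m k<p)
      ... | no k≮p = begin
        P k                       ≡⟨ cong P k′+p≡k ⟨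
        P (k′ + p)                ≡⟨ shift₁ P-periodic k′ ⟩
        P k′                      ≡⟨ ih k′<k (<-trans (+-monoʳ-< (suc a) k′<k) k<) ⟩
        L (suc a + k′)            ≡⟨ repeats (suc a + k′) (m≤m+n (suc a) k′) in-range ⟩
        L (suc a + k′ + p)        ≡⟨ cong L a+k′+p ⟩
        L (suc a + k)             ∎
        where
        open ≡-Reasoning
        k′ = k ∸ p
        k′+p≡k : k′ + p ≡ k
        k′+p≡k = m∸n+n≡m (≮⇒≥ k≮p)
        k′<k : k′ < k
        k′<k = subst (k′ <_) k′+p≡k (m<m+n k′ (s≤s z≤n))
        a+k′+p : suc a + k′ + p ≡ suc a + k
        a+k′+p = trans (+-assoc (suc a) k′ p) (cong (suc a +_) k′+p≡k)
        in-range : suc a + k′ < c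
        in-range = +-cancelʳ-< p _ _ (subst (_< c + p) (sym a+k′+p) k<)

    aperiodic : ∀ t → 0 < t → t < p → ¬ (∀ k → P k ≡ P (k + t))
    aperiodic t 0<t t<p eq = smallest t 0<t t<p λ k a<k k+t< →
      let k′ = k ∸ suc a
          e : suc a + k′ ≡ k
          e = m+[n∸m]≡n a<k
          e′ : suc a + (k′ + t) ≡ k + t
          e′ = trans (sym (+-assoc (suc a) k′ t)) (cong (_+ t) e)
          k< : k < c + p
          k< = ≤-<-trans (m≤m+n k t) k+t<
      in trans (cong L (sym e)) (trans (sym (P≡L k′ (subst (_< c + p) (sym e) k<)))
          (trans (eq k′) (trans (P≡L (k′ + t) (subst (_< c + p) (sym e′) k+t<)) (cong L e′))))

    b : ℕ
    b = proj₁ (least-rotation P-periodic)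

    b<p : b < p
    b<p = proj₁ (proj₂ (least-rotation P-periodic))

    β x : ℕ
    β = suc b
    x = a + β

    least : ∀ y → ¬ Lex _≺_ (dropₛ y P) (dropₛ β P)
    least = proj₂ (proj₂ (least-rotation P-periodic))

    x<c : x < c
    x<c = ≤-<-trans (+-monoʳ-≤ a b<p) long

    P≡L-at : ∀ u → u < p → P (β + u) ≡ L (suc x + u)
    P≡L-at u u<p = trans (P≡L (β + u) (subst (_< c + p) e (+-mono-≤-< x<c u<p))) (cong L (sym e))
      where
      e : suc x + u ≡ suc a + (β + u)
      e = +-assoc (suc a) β u

    lyndon : ∀ t → 0 < t → t < p → Lex _≺_ (dropₛ (suc x) L) (dropₛ (suc x + t) L)
    lyndon t 0<t t<p with aperiodic⇒strict P-periodic aperiodic {β} least t 0<t t<p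
    ... | lt@(s , eq , below) with t + s <? p
    -- The mismatch falls within the first `p` letters of the root, where `P` and `L` coincide.
    ... | yes t+s<p = s , (λ k k<s → subst₂ _≡_ (fst k (<⇒≤ k<s)) (snd k (<⇒≤ k<s)) (eq k k<s)) ,
                      subst₂ _≺_ (fst s ≤-refl) (snd s ≤-refl) below
      where
      bound : ∀ k → k ≤ s → t + k < p
      bound k k≤s = ≤-<-trans (+-monoʳ-≤ t k≤s) t+s<p
      fst : ∀ k → k ≤ s → P (β + k) ≡ L (suc x + k)
      fst k k≤s = P≡L-at k (≤-<-trans (m≤n+m k t) (bound k k≤s))
      snd : ∀ k → k ≤ s → P (β + t + k) ≡ L (suc x + t + k)
      snd k k≤s = trans (cong P (+-assoc β t k))
                 (trans (P≡L-at (t + k) (bound k k≤s)) (cong L (sym (+-assoc (suc x) t k))))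
    -- Otherwise the Lyndon word has a border of length p ∸ t, and removing it
    -- exposes a rotation smaller than the least one.
    ... | no t+s≮p = contradiction
            (Lex-resp {dropₛ e (dropₛ β P)} {_} {dropₛ e (dropₛ (β + t) P)} (λ k → cong P (sym (+-assoc β e k))) wrap
               (Lex-drop e (λ k k<e → eq k (<-≤-trans k<e e≤s)) lt))
            (least (β + e))
      where
      e = p ∸ t
      e≤s : e ≤ s
      e≤s = m≤n+o⇒m∸n≤o p t (≮⇒≥ t+s≮p)
      arith : ∀ β t e k → β + t + (e + k) ≡ β + k + (t + e)
      arith = solve-∀
      wrap : ∀ k → P (β + t + (e + k)) ≡ P (β + k)
      wrap k = trans (cong P (trans (arith β t e k) (cong (β + k +_) (m+[n∸m]≡n (<⇒≤ t<p)))))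
                     (shift₁ P-periodic (β + k))

    descent : Lex _≺_ (dropₛ (suc x + p) L) (dropₛ (suc x) L)
    descent = s , before , subst₂ _≺_ (cong L (sym (trans (swap s) (cong (_+ p) x+s)))) (cong L (sym x+s)) end
      where
      -- The suffixes at `suc x` and `suc x + p` first differ where the period breaks, at `c`; there
      -- `end` decides.
      s = c ∸ suc x
      x+s : suc x + s ≡ c
      x+s = m+[n∸m]≡n x<c
      swap : ∀ k → suc x + p + k ≡ suc x + k + p
      swap k = xy∙z≈xz∙y +-commutativeSemigroup (suc x) p k
      before : ∀ k → k < s → L (suc x + p + k) ≡ L (suc x + k)
      before k k<s = trans (cong L (swap k)) (sym (repeats (suc x + k)
        (≤-trans (s≤s (m≤m+n a β)) (m≤m+n (suc x) k)) (subst (suc x + k <_) x+s (+-monoʳ-< (suc x) k<s))))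

  -- The period is the least positive shift leading to a smaller suffix, hence a function of `x`.
  root-period-unique : ∀ {x p p′} → 0 < p → 0 < p′ → Root _≺_ L x p → Root _≺_ L x p′ → p ≡ p′
  root-period-unique {p = p} {p′} 0<p 0<p′ (lyn , des) (lyn′ , des′) with <-cmp p p′
  ... | tri≈ _ e _  = e
  ... | tri< lt _ _ = contradiction des (Lex-asym (lyn′ p 0<p lt))
  ... | tri> _ _ gt = contradiction des′ (Lex-asym (lyn p′ 0<p′ gt))

  -- Equal letters would give suf (b + 1) ≺ suf (b + p) ≺ suf b ≺ suf (b + 1), where b = suc x.
  root-ends-differ : ∀ {x p} → 1 < p → Root _≺_ L x p → L (suc x) ≢ L (x + p)
  root-ends-differ {x} {suc (suc q)} (s≤s 0<q) (lyn , des) e =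
    Lex-asym (lyn 1 (s≤s z≤n) (s≤s (s≤s z≤n)))
      (Lex-trans {dropₛ (suc x + 1) L} {dropₛ (suc x + suc (suc q)) L} {dropₛ (suc x) L}
        (Lex-resp {dropₛ 1 (dropₛ (suc x) L)} {_} {dropₛ 1 (dropₛ (suc x + suc q) L)}
          (λ k → cong L (sym (+-assoc (suc x) 1 k))) (λ k → cong L (arith x q k))
          (Lex-drop {dropₛ (suc x) L} {dropₛ (suc x + suc q) L} 1 first (lyn (suc q) (s≤s z≤n) ≤-refl))) des)
    where
    arith : ∀ x q k → suc x + suc q + (1 + k) ≡ suc x + suc (suc q) + k
    arith = solve-∀
    arith₀ : ∀ x q → x + suc (suc q) ≡ suc x + suc q + 0
    arith₀ = solve-∀
    first : ∀ k → k < 1 → L (suc x + k) ≡ L (suc x + suc q + k)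
    first zero    _ = trans (cong L (+-identityʳ (suc x))) (trans e (cong L (arith₀ x q)))
    first (suc _) (s≤s ())

-- Roots for both letter orders determine their runs.

private
  module Up   = RootsOf <-isStrictTotalOrder
  module Down = RootsOf (Flip.isStrictTotalOrder <-isStrictTotalOrder)

-- The root starts at `suc x`; since `a < x < c`, the letter just before it also repeats,
-- `L x ≡ L (x + p)`. The inequality at `c` records which order is in force.
record Anchor (L : Seq) (a c p : ℕ) : Set where
  field
    x    : ℕ
    a<x  : a < x
    x≤   : x ≤ a + p
    root : (L (c + p) < L c × Root _<_ L x p) ⊎ (L c < L (c + p) × Root _>_ L x p)

  x<c : Run L a c p → x < c
  x<c r = ≤-<-trans x≤ (Run.long r)

anchor : ∀ {L a c p} → Run L a c p → Anchor L a c p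
anchor {L} {a} {c} {p} r with <-cmp (L (c + p)) (L c)
... | tri< lt _ _ = let x , a<x , x≤ , root = Up.root-exists L r lt in
                    record { x = x ; a<x = a<x ; x≤ = x≤ ; root = inj₁ (lt , root) }
... | tri≈ _ e _  = contradiction (sym e) (Run.right r)
... | tri> _ _ gt = let x , a<x , x≤ , root = Down.root-exists L r gt in
                    record { x = x ; a<x = a<x ; x≤ = x≤ ; root = inj₂ (gt , root) }

-- If both periods exceed 1, the two orders compare the suffixes at `suc x` and at the next position
-- in contradictory ways. If exactly one is 1, the first and last letters of the longer root both
-- equal `L x`, against `root-ends-differ`.
opposite-roots : ∀ {L x p p′} → 0 < p → 0 < p′ → L x ≡ L (x + p) → L x ≡ L (x + p′) →
                 Root _<_ L x p → Root _>_ L x p′ → p ≡ p′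
opposite-roots {L} {x} {suc zero} {suc zero} _ _ _ _ _ _ = refl
opposite-roots {L} {x} {suc zero} {suc (suc q)} _ _ e e′ _ root′ =
  contradiction (trans (cong L (sym (+-comm x 1))) (trans (sym e) e′)) (Down.root-ends-differ L (s≤s (s≤s z≤n)) root′)
opposite-roots {L} {x} {suc (suc q)} {suc zero} _ _ e e′ root _ =
  contradiction (trans (cong L (sym (+-comm x 1))) (trans (sym e′) e)) (Up.root-ends-differ L (s≤s (s≤s z≤n)) root)
opposite-roots {L} {x} {suc (suc q)} {suc (suc q′)} _ _ _ _ (lyn , _) (lyn′ , _) =
  contradiction (Lex-flip (lyn′ 1 (s≤s z≤n) (s≤s (s≤s z≤n))))
    (LexOrder.Lex-asym <-isStrictTotalOrder (lyn 1 (s≤s z≤n) (s≤s (s≤s z≤n))))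

-- If the intervals differed, a boundary of one would lie inside the other, where the letter
-- repeats, against maximality.
run-determined : ∀ {L a c a′ c′ p x} → Run L a c p → Run L a′ c′ p →
                 a < x → x < c → a′ < x → x < c′ → a ≡ a′ × c ≡ c′
run-determined {L} {a} {c} {a′} {c′} r r′ a<x x<c a′<x x<c′ = starts , ends
  where
  starts : a ≡ a′
  starts with <-cmp a a′
  ... | tri< lt _ _ = contradiction (Run.repeats r a′ lt (<-trans a′<x x<c)) (Run.left r′)
  ... | tri≈ _ e _  = e
  ... | tri> _ _ gt = contradiction (Run.repeats r′ a gt (<-trans a<x x<c′)) (Run.left r)
  ends : c ≡ c′
  ends with <-cmp c c′
  ... | tri< lt _ _ = contradiction (Run.repeats r′ c (<-trans a′<x x<c) lt) (Run.right r)
  ... | tri≈ _ e _  = e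
  ... | tri> _ _ gt = contradiction (Run.repeats r c′ (<-trans a<x x<c′) gt) (Run.right r′)

anchor-injective : ∀ {L a c p a′ c′ p′} → Run L a c p → Run L a′ c′ p′ →
                   (A : Anchor L a c p) (A′ : Anchor L a′ c′ p′) → Anchor.x A ≡ Anchor.x A′ →
                   a ≡ a′ × c ≡ c′ × p ≡ p′
anchor-injective {L} {a} {c} {p} {a′} {c′} {p′} r r′ A A′ refl with periods (A .Anchor.root) (A′ .Anchor.root)
  where
  open Anchor A
  module A′ = Anchor A′
  0<p  = Run.positive r
  0<p′ = Run.positive r′
  e  = Run.repeats r x a<x (x<c r)
  e′ = Run.repeats r′ x A′.a<x (A′.x<c r′)
  periods : (L (c + p) < L c × Root _<_ L x p) ⊎ (L c < L (c + p) × Root _>_ L x p) →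
            (L (c′ + p′) < L c′ × Root _<_ L x p′) ⊎ (L c′ < L (c′ + p′) × Root _>_ L x p′) → p ≡ p′
  periods (inj₁ (_ , ρ)) (inj₁ (_ , ρ′)) = Up.root-period-unique L 0<p 0<p′ ρ ρ′
  periods (inj₁ (_ , ρ)) (inj₂ (_ , ρ′)) = opposite-roots {L} {x} 0<p 0<p′ e e′ ρ ρ′
  periods (inj₂ (_ , ρ)) (inj₁ (_ , ρ′)) = sym (opposite-roots {L} {x} 0<p′ 0<p e′ e ρ′ ρ)
  periods (inj₂ (_ , ρ)) (inj₂ (_ , ρ′)) = Down.root-period-unique L 0<p 0<p′ ρ ρ′
... | refl = let e , e′ = run-determined r r′ (A .Anchor.a<x) (Anchor.x<c A r) (A′ .Anchor.a<x) (Anchor.x<c A′ r′)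
             in e , e′ , refl

-- Letters ordered by last occurrence, and the position assigned to each run.

Lex-head : ∀ {f g} → f 0 < g 0 → ¬ Lex _>_ f g
Lex-head lt (zero  , _ , gt) = <-asym lt gt
Lex-head lt (suc _ , eq , _) = <-irrefl (eq 0 (s≤s z≤n)) lt

-- In the application `L k` is the last occurrence of the letter at `k`, so comparing values
-- compares letters by last occurrence.
module Marking (L : Seq) (inflationary : ∀ k → k ≤ L k) where

  -- If the letter at `suc x` repeated one period later, its value would be at least `suc x + p`. So
  -- the repetition stops there, at `c`, and the letter at `c + p` is larger, which selects the
  -- order `>`.
  no-later : ∀ {a c p} → Run L a c p → (A : Anchor L a c p) → let open Anchor A in
             L (suc x) < suc x + p → c ≡ suc x × Root _>_ L x p
  no-later {a} {c} {p} r A early with m≤n⇒m<n∨m≡n (Anchor.x<c A r)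
  ... | inj₁ b<c = contradiction (≤-<-trans (≤-reflexive (sym (Run.repeats r _ (<-trans a<x (n<1+n x)) b<c))) early)
                                 (≤⇒≯ (inflationary (suc x + p)))
    where open Anchor A
  ... | inj₂ b≡c with Anchor.root A
  ...   | inj₂ (_ , ρ)  = sym b≡c , ρ
  ...   | inj₁ (lt , _) = contradiction (<-trans lt (subst (λ z → L z < z + p) b≡c early)) (≤⇒≯ (inflationary (c + p)))

  -- In the case pair, the run is a square of one letter whose second position is the last occurrence
  -- of that letter: its only root is then unavailable, but its first position is free.
  data Marks (a c p : ℕ) : ℕ → Set where
    root : (A : Anchor L a c p) → L (suc (Anchor.x A)) ≢ suc (Anchor.x A) → Marks a c p (suc (Anchor.x A))
    pair : p ≡ 1 → c ≡ suc (suc a) → L (suc a) ≡ suc (suc a) → Marks a c p (suc a)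

  lyndon₁ : ∀ {x q} → Root _>_ L x (suc (suc q)) → Lex _>_ (dropₛ (suc x) L) (dropₛ (suc x + 1) L)
  lyndon₁ (lyn , _) = lyn 1 (s≤s z≤n) (s≤s (s≤s z≤n))

  -- A letter at its last occurrence is smaller than the letter that follows it, so the first
  -- letters already decide.
  last-not-descending : ∀ y → L y ≡ y → ¬ Lex _>_ (dropₛ y L) (dropₛ (y + 1) L)
  last-not-descending y Ly = Lex-head {dropₛ y L} {dropₛ (y + 1) L} (begin-strict
    L (y + 0)     ≡⟨ trans (cong L (+-identityʳ y)) Ly ⟩
    y             <⟨ n<1+n y ⟩
    suc y         ≡⟨ sym (trans (+-identityʳ (y + 1)) (+-comm y 1)) ⟩
    y + 1 + 0     ≤⟨ inflationary (y + 1 + 0) ⟩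
    L (y + 1 + 0) ∎)
    where open ≤-Reasoning

  -- By `no-later` the root is one for `>`. A period above 1 would make the suffix following a last
  -- occurrence smaller, so the period is 1 and `x` can only be `suc a`.
  last-root⇒pair : ∀ {a c p} → Run L a c p → (A : Anchor L a c p) → let open Anchor A in
                   L (suc x) ≡ suc x → Marks a c p (suc a)
  last-root⇒pair {a} {c} {p} r A last with no-later r A (subst (_< suc (Anchor.x A) + p) (sym last) (m<m+n _ (Run.positive r)))
  last-root⇒pair {p = zero}        r A last | _     = contradiction (Run.positive r) λ ()
  last-root⇒pair {p = suc (suc q)} r A last | _ , ρ = contradiction (lyndon₁ ρ) (last-not-descending _ last)
  last-root⇒pair {a} {c} {suc zero} r A last | c≡1+x , ρ = pair refl (trans c≡1+x (cong suc x≡1+a)) (begin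
      L (suc a)     ≡⟨ cong L x≡1+a ⟨
      L x           ≡⟨ Run.repeats r x a<x (x<c r) ⟩
      L (x + 1)     ≡⟨ cong L (+-comm x 1) ⟩
      L (suc x)     ≡⟨ last ⟩
      suc x         ≡⟨ cong suc x≡1+a ⟩
      suc (suc a)   ∎)
    where
    open Anchor A
    open ≡-Reasoning
    x≡1+a : x ≡ suc a
    x≡1+a = ≤-antisym (subst (x ≤_) (+-comm a 1) x≤) a<x

  mark : ∀ {a c p} → Run L a c p → ∃ (Marks a c p)
  mark {a} r with anchor r
  ... | A with L (suc (Anchor.x A)) ≟ suc (Anchor.x A)
  ...   | no ¬last = suc (Anchor.x A) , root A ¬last
  ...   | yes last = suc a , last-root⇒pair r A last

  mark-not-last : ∀ {a c p y} → Marks a c p y → L y ≢ y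
  mark-not-last (root A ¬last) = ¬last
  mark-not-last (pair _ _ e) e′ = contradiction (trans (sym e) e′) 1+n≢n

  -- This keeps the fallback position of `pair` free. A second run of period 1 would contradict left
  -- maximality of the square. For a larger period `no-later` gives a root for `>`; dropping its
  -- first letter leaves a descent right after a last occurrence.
  pair≢root : ∀ {a c} → Run L a c 1 → c ≡ suc (suc a) → L (suc a) ≡ suc (suc a) →
              ∀ {a′ c′ p′} → Run L a′ c′ p′ → (A : Anchor L a′ c′ p′) → a ≢ Anchor.x A
  pair≢root r _ _ {p′ = zero} r′ _ _ = contradiction (Run.positive r′) λ ()
  pair≢root r _ _ {p′ = suc zero} r′ A refl = Run.left r (Run.repeats r′ _ (Anchor.a<x A) (Anchor.x<c A r′))
  pair≢root {a} r refl e {p′ = p′@(suc (suc q))} r′ A refl =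
    last-not-descending (suc a + 1) last
      (Lex-resp {dropₛ 1 (dropₛ (suc a) L)} {_} {dropₛ 1 (dropₛ (suc a + 1) L)}
        (λ k → cong L (sym (+-assoc (suc a) 1 k))) (λ k → cong L (sym (+-assoc (suc a + 1) 1 k)))
        (Lex-drop {dropₛ (suc a) L} {dropₛ (suc a + 1) L} 1 first (lyndon₁ (proj₂ (no-later r′ A early)))))
    where
    open LexOrder (Flip.isStrictTotalOrder <-isStrictTotalOrder)
    same : L (suc a) ≡ L (suc a + 1)
    same = Run.repeats r (suc a) ≤-refl ≤-refl
    last : L (suc a + 1) ≡ suc a + 1
    last = trans (sym same) (trans e (+-comm 1 (suc a)))
    early : L (suc a) < suc a + p′
    early = subst₂ _<_ (sym e) refl (subst (suc (suc a) <_) (+-comm p′ (suc a)) (s≤s (s≤s (m≤n+m (suc a) q))))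
    first : ∀ k → k < 1 → L (suc a + k) ≡ L (suc a + 1 + k)
    first zero    _ = trans (cong L (+-identityʳ (suc a))) (trans same (cong L (sym (+-identityʳ (suc a + 1)))))
    first (suc _) (s≤s ())

  mark-injective : ∀ {a c p a′ c′ p′ y y′} → Run L a c p → Run L a′ c′ p′ →
                   Marks a c p y → Marks a′ c′ p′ y′ → y ≡ y′ → a ≡ a′ × c ≡ c′ × p ≡ p′
  mark-injective r r′ (root A _)         (root A′ _)       e    = anchor-injective r r′ A A′ (suc-injective e)
  mark-injective r r′ (root A _)         (pair refl e₁ e₂) e    = contradiction (sym (suc-injective e)) (pair≢root r′ e₁ e₂ r A)
  mark-injective r r′ (pair refl e₁ e₂)  (root A _)        e    = contradiction (suc-injective e) (pair≢root r e₁ e₂ r′ A)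
  mark-injective r r′ (pair refl refl _) (pair refl refl _) refl = refl , refl , refl

  -- This provides the extra unit in the sharper bound. A root at `s` forces `L x` above `suc x` for
  -- the preceding `x`: period 1 gives `L x ≡ L s`, and a longer period a copy at distance at least
  -- two. In the case `pair`, `L s` would be only `suc s`.
  mark-avoids : ∀ {s} → (∀ k → k < s → L k ≤ suc k) → suc s < L s →
                ∀ {a c p y} → Run L a c p → Marks a c p y → y ≢ s
  mark-avoids near far r (pair _ _ e) refl = <-irrefl (sym e) far
  mark-avoids near far {p = zero} r (root _ _) refl = contradiction (Run.positive r) λ ()
  mark-avoids near far {p = suc zero} r (root A _) refl =
    <-irrefl (trans (Run.repeats r x a<x (x<c r)) (cong L (+-comm x 1)))
             (≤-<-trans (near x ≤-refl) (<-trans (n<1+n (suc x)) far))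
    where open Anchor A
  mark-avoids near far {p = suc (suc q)} r (root A _) refl = <-irrefl refl (begin-strict
    suc x               <⟨ n<1+n (suc x) ⟩
    suc (suc x)         ≤⟨ s≤s (s≤s (m≤n+m x q)) ⟩
    suc (suc q) + x     ≡⟨ +-comm (suc (suc q)) x ⟩
    x + suc (suc q)     ≤⟨ inflationary (x + suc (suc q)) ⟩
    L (x + suc (suc q)) ≡⟨ sym (Run.repeats r x a<x (x<c r)) ⟩
    L x                 ≤⟨ near x ≤-refl ⟩
    suc x               ∎)
    where
    open Anchor A
    open ≤-Reasoning

-- Pigeonhole principle, and lists mapped along membership proofs.

lookup-injective : ∀ {A : Set} {xs : List A} → Unique xs → ∀ {i j} → lookup xs i ≡ lookup xs j → i ≡ j
lookup-injective (_ ∷ _) {Fin.zero}  {Fin.zero}  _ = refl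
lookup-injective (x≢ ∷ _) {Fin.zero}  {Fin.suc j} e = contradiction e (All.lookup x≢ (∈-lookup j))
lookup-injective (x≢ ∷ _) {Fin.suc i} {Fin.zero}  e = contradiction (sym e) (All.lookup x≢ (∈-lookup i))
lookup-injective (_ ∷ u) {Fin.suc i} {Fin.suc j} e = cong Fin.suc (lookup-injective u e)

unique-⊆-length : ∀ {A : Set} {xs ys : List A} → Unique xs → (∀ {x} → x ∈ xs → x ∈ ys) →
                  length xs ≤ length ys
unique-⊆-length {A} {xs} u sub = injective⇒≤ {f = λ i → index (sub (∈-lookup {xs = xs} i))}
  λ {i} {j} e → lookup-injective u (index-injective (setoid A) (sub (∈-lookup i)) (sub (∈-lookup j)) e)

module _ {A B : Set} {P : A → Set} (f : ∀ {x} → P x → B) where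

  length-reduce : ∀ {xs} (pxs : All P xs) → length (All.reduce f pxs) ≡ length xs
  length-reduce []         = refl
  length-reduce (_ ∷ pxs) = cong suc (length-reduce pxs)

  All-reduce : ∀ {Q : B → Set} → (∀ {x} (px : P x) → Q (f px)) → ∀ {xs} (pxs : All P xs) → All Q (All.reduce f pxs)
  All-reduce q []         = []
  All-reduce q (px ∷ pxs) = q px ∷ All-reduce q pxs

  -- The position of a run is computed from the proof that it is a run, so injectivity is required
  -- across all such proofs.
  Unique-reduce : (∀ {x y} (px : P x) (py : P y) → f px ≡ f py → x ≡ y) →
                  ∀ {xs} → Unique xs → (pxs : All P xs) → Unique (All.reduce f pxs)
  Unique-reduce inj []       []         = []
  Unique-reduce inj (x≢ ∷ u) (px ∷ pxs) = fresh x≢ pxs ∷ Unique-reduce inj u pxs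
    where
    fresh : ∀ {xs} → All (_ ≢_) xs → (pxs : All P xs) → All (f px ≢_) (All.reduce f pxs)
    fresh []        []         = []
    fresh (n ∷ ns) (py ∷ pys) = (λ e → n (inj px py e)) ∷ fresh ns pys

  ∈-reduce : ∀ {xs x} (pxs : All P xs) (x∈ : x ∈ xs) → f (All.lookup pxs x∈) ∈ All.reduce f pxs
  ∈-reduce (_ ∷ _)   (here refl) = here refl
  ∈-reduce (_ ∷ pxs) (there x∈)  = there (∈-reduce pxs x∈)

-- Positions and last occurrences of letters in a word.

∈⇒at : ∀ {n x} {w : Vec ℕ n} → x VM.∈ w → ∃ λ k → 1 ≤ k × k ≤ n × at w k ≡ x
∈⇒at (VAny.here refl) = 1 , ≤-refl , s≤s z≤n , refl
∈⇒at (VAny.there x∈) with ∈⇒at x∈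
... | suc k , _ , k≤n , e = suc (suc k) , s≤s z≤n , s≤s k≤n , e

at-∈ : ∀ {n} (w : Vec ℕ n) k → 1 ≤ k → k ≤ n → at w k VM.∈ w
at-∈ (x ∷ w) (suc zero)    _ _         = VAny.here refl
at-∈ (x ∷ w) (suc (suc k)) _ (s≤s k≤n) = VAny.there (at-∈ w (suc k) (s≤s z≤n) k≤n)

module _ {n : ℕ} (w : Vec ℕ n) where

  lastUpTo : ℕ → ℕ → ℕ
  lastUpTo x zero = 0
  lastUpTo x (suc m) with at w (suc m) ≟ x
  ... | yes _ = suc m
  ... | no _  = lastUpTo x m

  lastUpTo-≤ : ∀ x m → lastUpTo x m ≤ m
  lastUpTo-≤ x zero = z≤n
  lastUpTo-≤ x (suc m) with at w (suc m) ≟ x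
  ... | yes _ = ≤-refl
  ... | no _  = m≤n⇒m≤1+n (lastUpTo-≤ x m)

  lastUpTo-spec : ∀ x m {k} → 1 ≤ k → k ≤ m → at w k ≡ x → k ≤ lastUpTo x m × at w (lastUpTo x m) ≡ x
  lastUpTo-spec x zero    (s≤s _) () _
  lastUpTo-spec x (suc m) 1≤k k≤ e with at w (suc m) ≟ x
  ... | yes e′ = k≤ , e′
  ... | no ≢x with m≤n⇒m<n∨m≡n k≤
  ...   | inj₁ (s≤s k≤m) = lastUpTo-spec x m 1≤k k≤m e
  ...   | inj₂ refl      = contradiction e ≢x

  -- Positions outside 1..n count as occurrences of pairwise different fresh letters.
  last : Seq
  last zero = zero
  last (suc k) with suc k ≤? n
  ... | yes _ = lastUpTo (at w (suc k)) n
  ... | no _  = suc k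

  last-inside : ∀ {k} → 1 ≤ k → k ≤ n → last k ≡ lastUpTo (at w k) n
  last-inside {suc k} _ k≤n with suc k ≤? n
  ... | yes _  = refl
  ... | no k≰n = contradiction k≤n k≰n

  last-outside : ∀ {k} → n < k → last k ≡ k
  last-outside {suc k} n<k with suc k ≤? n
  ... | yes k≤n = contradiction k≤n (<⇒≱ n<k)
  ... | no _    = refl

  last-inflationary : ∀ k → k ≤ last k
  last-inflationary zero = z≤n
  last-inflationary (suc k) with suc k ≤? n
  ... | yes k≤n = proj₁ (lastUpTo-spec (at w (suc k)) n (s≤s z≤n) k≤n refl)
  ... | no _    = ≤-refl

  last-cong : ∀ {k l} → 1 ≤ k → k ≤ n → 1 ≤ l → l ≤ n → at w k ≡ at w l → last k ≡ last l
  last-cong 1≤k k≤n 1≤l l≤n e =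
    trans (last-inside 1≤k k≤n) (trans (cong (λ x → lastUpTo x n) e) (sym (last-inside 1≤l l≤n)))

  -- A letter can be read back at its last occurrence, so on positions 1 to `n` the sequence `last`
  -- is `w` with its letters renamed injectively.
  last-reflects : ∀ {k l} → 1 ≤ k → k ≤ n → 1 ≤ l → l ≤ n → last k ≡ last l → at w k ≡ at w l
  last-reflects 1≤k k≤n 1≤l l≤n e = trans (sym (proj₂ (lastUpTo-spec _ n 1≤k k≤n refl)))
    (trans (cong (at w) (trans (sym (last-inside 1≤k k≤n)) (trans e (last-inside 1≤l l≤n))))
           (proj₂ (lastUpTo-spec _ n 1≤l l≤n refl)))

  moved⇒inside : ∀ {k} → last k ≢ k → 1 ≤ k × k ≤ n
  moved⇒inside {zero}  ≢k = contradiction refl ≢k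
  moved⇒inside {suc k} ≢k = s≤s z≤n , ≮⇒≥ (λ n<k → ≢k (last-outside n<k))

  lastUpTo-fixed : ∀ {x} → x VM.∈ w → 1 ≤ lastUpTo x n × at w (lastUpTo x n) ≡ x × last (lastUpTo x n) ≡ lastUpTo x n
  lastUpTo-fixed {x} x∈ = 1≤l , at≡x , trans (last-inside 1≤l (lastUpTo-≤ x n)) (cong (λ y → lastUpTo y n) at≡x)
    where
    occ = ∈⇒at x∈
    spec = lastUpTo-spec x n (proj₁ (proj₂ occ)) (proj₁ (proj₂ (proj₂ occ))) (proj₂ (proj₂ (proj₂ occ)))
    1≤l = ≤-trans (proj₁ (proj₂ occ)) (proj₁ spec)
    at≡x = proj₂ spec

  -- From runs of the word to runs of the sequence of last occurrences.

  toRun : ∀ {i j p} → IsRun w (i , j , p) → Run last (i ∸ 1) ((j + 1) ∸ p) p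
  toRun {suc a} {j} {p} (_ , i≤j , j≤n , ((1≤p , period) , smallest) , 2p≤ , left , right) = record
    { positive = 1≤p
    ; long     = long
    ; left     = left′ a refl left
    ; repeats  = λ k a<k k<c → let k+p≤j = inside k<c in
        subst (λ z → last z ≡ last (z + p)) (m+[n∸m]≡n (<⇒≤ a<k))
          (last-cong (≤-trans (m<n⇒0<n∸m a<k) (m≤n+m _ a))
                     (≤-trans (≤-reflexive (m+[n∸m]≡n (<⇒≤ a<k))) (≤-trans (m≤m+n k p) (≤-trans k+p≤j j≤n)))
                     (≤-trans (m<n⇒0<n∸m a<k) (≤-trans (m≤n+m _ a) (m≤m+n _ p)))
                     (≤-trans (≤-reflexive (cong (_+ p) (m+[n∸m]≡n (<⇒≤ a<k)))) (≤-trans k+p≤j j≤n))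
                     (period (k ∸ a) (m<n⇒0<n∸m a<k) (subst (λ z → k ∸ a + p ≤ z ∸ suc a) (sym j+1)
                       (m+n≤o⇒m≤o∸n _ (subst (_≤ j) (sym (trans (xy∙z≈xz∙y +-commutativeSemigroup (k ∸ a) p a) (cong (_+ p) (m∸n+n≡m (<⇒≤ a<k))))) k+p≤j)))))
    ; right    = right′ (m≤n⇒m<n∨m≡n j≤n) right
    ; smallest = λ t 0<t t<p eq → smallest t t<p (0<t , λ m 1≤m m+t≤ →
        let a+m+t≤j : a + m + t ≤ j
            a+m+t≤j = subst (_≤ j) (shuffle m t a) (m≤o∸n⇒m+n≤o _ (<⇒≤ i≤j) (subst (λ z → m + t ≤ z ∸ suc a) j+1 m+t≤))
            1≤a+m = ≤-trans 1≤m (m≤n+m m a)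
            a+m+t≤n = ≤-trans a+m+t≤j j≤n
        in last-reflects 1≤a+m (≤-trans (m≤m+n _ t) a+m+t≤n) (≤-trans 1≤a+m (m≤m+n _ t)) a+m+t≤n
             (eq (a + m) (m<m+n a 1≤m) (subst (a + m + t <_) (sym (trans c+p j+1)) (s≤s a+m+t≤j))))
    }
    where
    c = (j + 1) ∸ p
    j+1 : j + 1 ≡ suc j
    j+1 = +-comm j 1
    shuffle : ∀ m t a → m + t + a ≡ a + m + t
    shuffle = solve-∀
    arith : ∀ p a → 2 * p + suc a ≡ suc (a + p) + p
    arith = solve-∀
    length≤ : suc (a + p) + p ≤ j + 1
    length≤ = subst (_≤ j + 1) (arith p a) (m≤o∸n⇒m+n≤o (2 * p) (≤-trans i≤j (m≤m+n j 1)) 2p≤)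
    long : a + p < c
    long = m+n≤o⇒m≤o∸n _ length≤
    c+p : c + p ≡ j + 1
    c+p = m∸n+n≡m (≤-trans (m≤n+m p (suc (a + p))) length≤)
    inside : ∀ {k} → k < c → k + p ≤ j
    inside {k} k<c = ≤-pred (subst (suc (k + p) ≤_) (trans c+p j+1) (+-monoˡ-≤ p k<c))
    1≤c : 1 ≤ c
    1≤c = ≤-trans (s≤s z≤n) long
    c≤j : c ≤ j
    c≤j = ≤-pred (subst (suc c ≤_) (trans c+p j+1) (subst (_≤ c + p) (+-comm c 1) (+-monoʳ-≤ c 1≤p)))
    left′ : ∀ a′ → a′ ≡ a → suc a ≡ 1 ⊎ at w a ≢ at w (a + p) → last a ≢ last (a + p)
    -- Position 0 is a sentinel: `last 0` is 0, whereas `last p` is at least `p`, hence positive.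
    left′ zero     refl _          e = contradiction (subst (1 ≤_) (sym e) (≤-trans 1≤p (last-inflationary p))) λ ()
    left′ (suc a′) refl (inj₂ ≢at) e = ≢at (last-reflects (s≤s z≤n)
      (≤-trans (m≤m+n _ p) a+p≤n) (s≤s z≤n) a+p≤n e)
      where
      a+p≤n : suc a′ + p ≤ n
      a+p≤n = ≤-trans (<⇒≤ long) (≤-trans c≤j j≤n)
    right′ : j < n ⊎ j ≡ n → j ≡ n ⊎ at w (j + 1) ≢ at w c → last c ≢ last (c + p)
    right′ (inj₁ j<n) (inj₁ j≡n) e = <-irrefl j≡n j<n
    right′ (inj₁ j<n) (inj₂ ≢at) e = ≢at (last-reflects (m≤n+m 1 j) (subst (_≤ n) (sym j+1) j<n) 1≤c (≤-trans c≤j j≤n)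
      (trans (cong last (sym c+p)) (sym e)))
    -- Position `n + 1` is the other sentinel: its value exceeds `n`, which no value inside the word
    -- does.
    right′ (inj₂ refl) _ e = <-irrefl refl (begin-strict
      n                   <⟨ n<1+n n ⟩
      suc n               ≤⟨ last-inflationary (suc n) ⟩
      last (suc n)        ≡⟨ cong last (trans c+p j+1) ⟨
      last (c + p)        ≡⟨ e ⟨
      last c              ≡⟨ last-inside 1≤c c≤j ⟩
      lastUpTo (at w c) n ≤⟨ lastUpTo-≤ (at w c) n ⟩
      n                   ∎)
      where open ≤-Reasoning

  toRun-injective : ∀ {i j p i′ j′ p′} → IsRun w (i , j , p) → IsRun w (i′ , j′ , p′) →
    i ∸ 1 ≡ i′ ∸ 1 × (j + 1) ∸ p ≡ (j′ + 1) ∸ p′ × p ≡ p′ → (i , j , p) ≡ (i′ , j′ , p′)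
  toRun-injective {suc a} {j} {p} {suc _} {j′} r r′ (refl , e , refl) =
    cong (λ z → suc a , z , p) (+-cancelʳ-≡ 1 j j′ (∸-cancelʳ-≡ (p≤ r) (p≤ r′) e))
    where
    p≤ : ∀ {i j p} → IsRun w (i , j , p) → p ≤ j + 1
    p≤ {i} {j} {p} (_ , _ , _ , _ , 2p≤ , _) = ≤-trans (m≤m+n p _) (≤-trans 2p≤ (m∸n≤m (j + 1) i))

  open Marking last last-inflationary

  slot : ∀ {r} → IsRun w r → ℕ
  slot r = proj₁ (mark (toRun r))

  slot-injective : ∀ {r r′} (ρ : IsRun w r) (ρ′ : IsRun w r′) → slot ρ ≡ slot ρ′ → r ≡ r′
  slot-injective ρ ρ′ e = toRun-injective ρ ρ′
    (mark-injective (toRun ρ) (toRun ρ′) (proj₂ (mark (toRun ρ))) (proj₂ (mark (toRun ρ′))) e)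

  slot-not-last : ∀ {r} (ρ : IsRun w r) → last (slot ρ) ≢ slot ρ
  slot-not-last ρ = mark-not-last (proj₂ (mark (toRun ρ)))

  -- Counting the occupied positions.

  first-far : ∀ m → (∀ k → k < m → last k ≤ suc k) ⊎ (∃ λ s → (∀ k → k < s → last k ≤ suc k) × suc s < last s)
  first-far zero = inj₁ λ _ ()
  first-far (suc m) with first-far m
  ... | inj₂ s = inj₂ s
  ... | inj₁ near with suc m <? last m
  ...   | yes far = inj₂ (m , near , far)
  ...   | no ¬far = inj₁ near′
    where
    near′ : ∀ k → k < suc m → last k ≤ suc k
    near′ k (s≤s k≤m) with m≤n⇒m<n∨m≡n k≤m
    ... | inj₁ k<m  = near k k<m
    ... | inj₂ refl = ≮⇒≥ ¬far

  module Counting {d : ℕ} (symbols : HasDistinctSymbols w d)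
                  {rs : List (ℕ × ℕ × ℕ)} (rs-unique : Unique rs) (runs : All (IsRun w) rs) where
    private
      xs       = proj₁ symbols
      xs-unique = proj₁ (proj₂ symbols)
      ∣xs∣≡d   = proj₁ (proj₂ (proj₂ symbols))
      occurs   = proj₂ (proj₂ (proj₂ symbols))

      xs⊆w : All (VM._∈ w) xs
      xs⊆w = All.tabulate λ {a} → Equivalence.to (occurs a)

      lastOf : ∀ {x} → x VM.∈ w → ℕ
      lastOf {x} _ = lastUpTo x n

      slots lasts : List ℕ
      slots = All.reduce slot runs
      lasts = All.reduce lastOf xs⊆w

      slots-moved : All (λ y → last y ≢ y) slots
      slots-moved = All-reduce slot slot-not-last runs

      lasts-fixed : All (λ y → 1 ≤ y × y ≤ n × last y ≡ y) lasts
      lasts-fixed = All-reduce lastOf (λ {x} x∈ → let 1≤l , _ , fixed = lastUpTo-fixed x∈ in 1≤l , lastUpTo-≤ x n , fixed) xs⊆w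

      taken : List ℕ
      taken = slots ++ lasts

      taken-unique : Unique taken
      taken-unique = Unique.++⁺ (Unique-reduce slot slot-injective rs-unique runs)
        (Unique-reduce lastOf (λ x∈ y∈ e → trans (sym (proj₁ (proj₂ (lastUpTo-fixed x∈))))
           (trans (cong (at w) e) (proj₁ (proj₂ (lastUpTo-fixed y∈))))) xs-unique xs⊆w)
        -- The two lists are disjoint: `last` moves every slot and fixes every last occurrence.
        (λ (y∈ , y∈′) → All.lookup slots-moved y∈ (proj₂ (proj₂ (All.lookup lasts-fixed y∈′))))

      taken-inside : All (λ y → 1 ≤ y × y ≤ n) taken
      taken-inside = All.++⁺ (All.map moved⇒inside slots-moved) (All.map (λ (1≤y , y≤n , _) → 1≤y , y≤n) lasts-fixed)

      ∣taken∣ : length taken ≡ length rs + d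
      ∣taken∣ = trans (length-++ slots) (cong₂ _+_ (length-reduce slot runs) (trans (length-reduce lastOf xs⊆w) ∣xs∣≡d))

      positions : List ℕ
      positions = applyUpTo suc n

      ∈-positions : ∀ {y} → 1 ≤ y × y ≤ n → y ∈ positions
      ∈-positions {suc y} (_ , y<n) = ∈-applyUpTo⁺ suc y<n

      inside-length : ∀ {ys} → Unique ys → All (λ y → 1 ≤ y × y ≤ n) ys → length ys ≤ n
      inside-length {ys} u ins = subst (length ys ≤_) (length-applyUpTo suc n)
        (unique-⊆-length u (λ y∈ → ∈-positions (All.lookup ins y∈)))

    runs-≤ : length rs ≤ n ∸ d
    runs-≤ = m+n≤o⇒m≤o∸n _ (subst (_≤ n) ∣taken∣ (inside-length taken-unique taken-inside))

    -- Each position is a last occurrence or the predecessor of one, and the list of last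
    -- occurrences has length `d`.
    all-near⇒short : (∀ k → k < suc n → last k ≤ suc k) → n ≤ 2 * d
    all-near⇒short near = subst₂ _≤_ (length-applyUpTo suc n) len
      (unique-⊆-length {ys = lasts ++ map pred lasts}
        (Unique.applyUpTo⁺₁ suc n (λ i<j _ e → <-irrefl (suc-injective e) i<j)) covered)
      where
      ∣lasts∣ : length lasts ≡ d
      ∣lasts∣ = trans (length-reduce lastOf xs⊆w) ∣xs∣≡d
      len : length (lasts ++ map pred lasts) ≡ 2 * d
      len = trans (length-++ lasts) (cong₂ _+_ ∣lasts∣ (trans (length-map pred lasts) (trans ∣lasts∣ (sym (+-identityʳ d)))))
      last∈ : ∀ {i} → i < n → last (suc i) ∈ lasts
      last∈ {i} i<n = subst (_∈ lasts) (sym (last-inside (s≤s z≤n) i<n))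
        (∈-reduce lastOf xs⊆w (Equivalence.from (occurs _) (at-∈ w (suc i) (s≤s z≤n) i<n)))
      covered : ∀ {k} → k ∈ positions → k ∈ lasts ++ map pred lasts
      covered k∈ with ∈-applyUpTo⁻ suc k∈
      ... | i , i<n , refl with m≤n⇒m<n∨m≡n (last-inflationary (suc i))
      ...   | inj₂ e  = ∈-++⁺ˡ (subst (_∈ lasts) (sym e) (last∈ i<n))
      ...   | inj₁ lt = ∈-++⁺ʳ lasts (subst (_∈ map pred lasts)
                          (cong pred (≤-antisym (near (suc i) (s≤s i<n)) lt)) (∈-map⁺ pred (last∈ i<n)))

    runs-< : 2 * d < n → length rs ≤ n ∸ d ∸ 1
    runs-< 2d<n with first-far (suc n)
    ... | inj₁ near = contradiction (all-near⇒short near) (<⇒≱ 2d<n)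
    -- The position `s` is neither a slot nor a last occurrence, so it joins the occupied positions
    -- as one more.
    ... | inj₂ (s , near , far) = m+n≤o⇒m≤o∸n _ (subst (_≤ n ∸ d) (+-comm 1 _) (m+n≤o⇒m≤o∸n _
          (subst (_≤ n) (cong suc ∣taken∣) (inside-length (fresh ∷ taken-unique) (moved⇒inside moved ∷ taken-inside)))))
      where
      moved : last s ≢ s
      moved e = <-asym far (subst (_< suc s) (sym e) (n<1+n s))
      fresh : All (s ≢_) taken
      fresh = All.++⁺ (All-reduce slot (λ ρ e → mark-avoids near far (toRun ρ) (proj₂ (mark (toRun ρ))) (sym e)) runs)
                      (All.map (λ { (_ , _ , fixed) refl → moved fixed }) lasts-fixed)

theorem4 : (n d : ℕ) → 1 ≤ d → d ≤ n →
    RhoAtMost n d (n ∸ d) × (2 * d < n → RhoAtMost n d (n ∸ d ∸ 1))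
theorem4 n d _ _ =
  (λ w symbols rs unique runs → Counting.runs-≤ w symbols unique runs) ,
  (λ 2d<n w symbols rs unique runs → Counting.runs-< w symbols unique runs 2d<n)
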